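{- Let $R$ be an order in $K$. The following algorithm is correct, i.e. it returns a list $\mathcal{L}^{iso}$ containing exactly one representative of each class in $\mathrm{ICM}(R)$. Compute the list $\mathcal{L}^o$ of all over-orders of $R$ and start with an empty list $\mathcal{L}^{iso}$. For each $S$ in $\mathcal{L}^o$, compute a list $\mathcal{L}^w_S$ of representatives of the classes of $\mathcal{W}_S(R)$ (one for each class) and a list $\mathcal{L}^i_S$ of representatives of the classes of $\mathrm{Pic}(S)$ (one for each class), and for each $I$ in $\mathcal{L}^w_S$ and each $J$ in $\mathcal{L}^i_S$ append $IJ$ to $\mathcal{L}^{iso}$. Return $\mathcal{L}^{iso}$.
   Context: An order is a commutative reduced ring $R$ with unit that is free and finitely generated as a $\mathbb{Z}$-module; its total quotient ring $K$ is a finite product of number fields, and $R$ is called an order in $K$. A fractional $R$-ideal is a finitely generated sub-$R$-module $I$ of $K$ with $I\otimes_{\mathbb Z}\mathbb{Q}=K$; $(I:J)=\{x\in K:xJ\subseteq I\}$, and $(I:I)$ is the multiplicator ring of $I$. An over-order of $R$ is a fractional $R$-ideal that is a subring of $K$ (so it contains $R$); there are finitely many. $\mathrm{ICM}(R)$ is the monoid of $R$-module isomorphism classes of fractional $R$-ideals ($I\simeq J$ iff $I=\alpha J$ for some $\alpha\in K^\times$). A fractional $S$-ideal $L$ is invertible if $LL'=S$ for some fractional $S$-ideal $L'$; $\mathrm{Pic}(S)$ is the group of isomorphism classes of invertible fractional $S$-ideals. Two fractional $R$-ideals $I,J$ are weakly equivalent if they satisfy the following equivalent conditions: $I_{\mathfrak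 p}\simeq J_{\mathfrak p}$ as $R_{\mathfrak p}$-modules for every maximal ideal $\mathfrak p$ of $R$; $1\in (I:J)(J:I)$; $I$ and $J$ have the same multiplicator ring $S$ and $I=LJ$ for some invertible fractional $S$-ideal $L$. $\mathcal{W}_S(R)$ is the set of weak equivalence classes of fractional $R$-ideals $I$ with $(I:I)=S$. -}

module Defs where

open import Algebra.Bundles using (CommutativeRing; Semiring)
open import Data.Fin.Base using (Fin)
open import Data.Integer.Base using (ℤ; +_; -[1+_]; 0ℤ)
open import Data.List.Base using (List; allFin; cartesianProductWith; concatMap; length)
open import Data.List.Relation.Unary.All using (All)
open import Data.List.Relation.Unary.AllPairs using (AllPairs)
open import Data.List.Relation.Unary.Any using (Any)
open import Data.Nat.Base using (ℕ; suc; NonZero)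
open import Data.Product.Base using (∃; ∃-syntax; _×_)
open import Data.Vec.Functional using (Vector)
open import Level using (Level; _⊔_) renaming (suc to lsuc)
open import Relation.Binary.Core using (Rel)
open import Relation.Binary.PropositionalEquality.Core using (_≡_)
open import Relation.Nullary.Negation.Core using (¬_)
open import Relation.Unary using (Pred; _∈_; _≐_)

-- A list of elements of P meeting every class of the relation ∼ on P exactly
-- once: every element of P is related to an entry, and entries at different
-- positions are unrelated.
record IsListOfRepresentatives {a p r} {A : Set a}
       (P : Pred A p) (_∼_ : Rel A r) (xs : List A) : Set (a ⊔ p ⊔ r) where
  field
    sound    : All P xs
    complete : ∀ x → x ∈ P → Any (x ∼_) xs
    distinct : AllPairs (λ x y → ¬ (x ∼ y)) xs

-- Everything lives inside the ambient ring K, the total quotient ring of the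
-- order under consideration.
module Orders {c ℓ} (K : CommutativeRing c ℓ) where

  open CommutativeRing K
  open import Algebra.Definitions.RawSemiring (Semiring.rawSemiring semiring)
    using (sum; _^_) renaming (_×_ to infixr 8 _ℕ·_)

  -- This level is closed under the colon and the product of subsets.
  Subset : Set (lsuc (c ⊔ ℓ))
  Subset = Pred Carrier (c ⊔ ℓ)

  infixr 8 _ℤ·_
  _ℤ·_ : ℤ → Carrier → Carrier
  (+ n)    ℤ· x = n ℕ· x
  -[1+ n ] ℤ· x = - (suc n ℕ· x)

  ℤ-Span : ∀ {n} → Vector Carrier n → Pred Carrier ℓ
  ℤ-Span {n} b x = ∃ λ (z : Vector ℤ n) → x ≈ sum (λ i → z i ℤ· b i)

  Span : Subset → ∀ {n} → Vector Carrier n → Subset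
  Span R {n} g x = ∃ λ (r : Vector Carrier n) → (∀ i → r i ∈ R) × x ≈ sum (λ i → r i * g i)

  record IsSubring (R : Subset) : Set (c ⊔ ℓ) where
    field
      resp     : ∀ {x y} → x ≈ y → x ∈ R → y ∈ R
      0-mem    : 0# ∈ R
      1-mem    : 1# ∈ R
      +-closed : ∀ {x y} → x ∈ R → y ∈ R → (x + y) ∈ R
      neg-mem  : ∀ {x} → x ∈ R → (- x) ∈ R
      *-closed : ∀ {x y} → x ∈ R → y ∈ R → (x * y) ∈ R

  record IsOrder (R : Subset) : Set (c ⊔ ℓ) where
    field
      isSubring   : IsSubring R
      reduced     : ∀ {x} → x ∈ R → ∀ n → x ^ n ≈ 0# → x ≈ 0#
      -- free and finitely generated over ℤ: there is a finite ℤ-basis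
      rank        : ℕ
      basis       : Vector Carrier rank
      spanning    : R ≐ ℤ-Span basis
      independent : ∀ (z : Vector ℤ rank) → sum (λ i → z i ℤ· basis i) ≈ 0# →
                    ∀ i → z i ≡ 0ℤ

  record IsNonZeroDivisor (R : Subset) (s : Carrier) : Set (c ⊔ ℓ) where
    field
      mem    : s ∈ R
      cancel : ∀ {t} → t ∈ R → s * t ≈ 0# → t ≈ 0#

  IsUnit : Carrier → Set (c ⊔ ℓ)
  IsUnit α = ∃[ β ] α * β ≈ 1#

  -- K is the localisation of R at its non-zero-divisors; the canonical map
  -- R → K is the inclusion.
  record IsTotalQuotientRing (R : Subset) : Set (c ⊔ ℓ) where
    field
      invertible : ∀ {s} → IsNonZeroDivisor R s → IsUnit s
      fraction   : ∀ x → ∃[ r ] ∃[ s ] r ∈ R × IsNonZeroDivisor R s × x * s ≈ r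

  -- Parametrised by an arbitrary subset R, so that for an order R in K it can
  -- be used for R-ideals as well as for S-ideals with S an over-order of R.
  record IsFractionalIdeal (R I : Subset) : Set (c ⊔ ℓ) where
    field
      resp              : ∀ {x y} → x ≈ y → x ∈ I → y ∈ I
      0-mem             : 0# ∈ I
      +-closed          : ∀ {x y} → x ∈ I → y ∈ I → (x + y) ∈ I
      *-closed          : ∀ {r x} → r ∈ R → x ∈ I → (r * x) ∈ I
      finitelyGenerated : ∃[ n ] ∃ λ (g : Vector Carrier n) → I ≐ Span R g
      -- I ⊗ ℚ = K: the multiplication map I ⊗ ℚ → K, x ⊗ 1/m ↦ x/m, is onto.
      -- (It is injective because ℚ is flat over ℤ and K is a ℚ-algebra.)
      full              : ∀ x → ∃[ m ] NonZero m × (m ℕ· x) ∈ I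

  infix  7 _∶_
  infixl 7 _·_
  infixr 8 _∙_
  infix  4 _≃_

  _∶_ : Subset → Subset → Subset
  (I ∶ J) x = ∀ {y} → y ∈ J → (x * y) ∈ I

  _·_ : Subset → Subset → Subset
  (I · J) x = ∃[ n ] ∃ λ (a : Vector Carrier n) → ∃ λ (b : Vector Carrier n) →
              (∀ i → a i ∈ I) × (∀ i → b i ∈ J) × x ≈ sum (λ i → a i * b i)

  _∙_ : Carrier → Subset → Subset
  (α ∙ J) x = ∃[ y ] y ∈ J × x ≈ α * y

  _≃_ : Rel Subset (c ⊔ ℓ)
  I ≃ J = ∃[ α ] IsUnit α × I ≐ α ∙ J

  IsOverOrder : Subset → Pred Subset (c ⊔ ℓ)
  IsOverOrder R S = IsFractionalIdeal R S × IsSubring S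

  IsInvertible : Subset → Pred Subset (lsuc (c ⊔ ℓ))
  IsInvertible S L = IsFractionalIdeal S L ×
                     (∃[ L′ ] IsFractionalIdeal S L′ × L · L′ ≐ S)

  WeaklyEquivalent : Rel Subset (c ⊔ ℓ)
  WeaklyEquivalent I J = 1# ∈ (I ∶ J) · (J ∶ I)

  HasMultiplicatorRing : Subset → Subset → Pred Subset (c ⊔ ℓ)
  HasMultiplicatorRing R S I = IsFractionalIdeal R I × (I ∶ I) ≐ S

  AreOverOrders : Subset → Pred (List Subset) (lsuc (c ⊔ ℓ))
  AreOverOrders R = IsListOfRepresentatives (IsOverOrder R) _≐_

  RepresentICM : Subset → Pred (List Subset) (lsuc (c ⊔ ℓ))
  RepresentICM R = IsListOfRepresentatives (IsFractionalIdeal R) _≃_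

  RepresentPic : Subset → Pred (List Subset) (lsuc (c ⊔ ℓ))
  RepresentPic S = IsListOfRepresentatives (IsInvertible S) _≃_

  Represent𝒲 : Subset → Subset → Pred (List Subset) (lsuc (c ⊔ ℓ))
  Represent𝒲 R S = IsListOfRepresentatives (HasMultiplicatorRing R S) WeaklyEquivalent

  -- The lists 𝓛ʷ and 𝓛ⁱ are indexed by the positions k in the list 𝓛ᵒ of
  -- over-orders.
  idealClassList : (𝓛ᵒ : List Subset) (𝓛ʷ 𝓛ⁱ : Fin (length 𝓛ᵒ) → List Subset) → List Subset
  idealClassList 𝓛ᵒ 𝓛ʷ 𝓛ⁱ =
    concatMap (λ k → cartesianProductWith _·_ (𝓛ʷ k) (𝓛ⁱ k)) (allFin (length 𝓛ᵒ))

{-# OPTIONS --safe #-}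

-- If I and W are weakly equivalent with multiplicator ring S, then L = (I : W)
-- is an invertible S-ideal with inverse (W : I) and I = W L, so every I is
-- isomorphic to an entry W J of the list.  Conversely S = (W J : W J) is
-- recovered from W J; if α W′ J′ ⊆ W J, then α J′ J⁻¹ ⊆ (W : W′), which
-- recovers the weak class of W, and J ≃ J′ when W = W′.
--
-- That (I : I) is an over-order has to be shown constructively.  Multiplication
-- by an integer brings every element of K into R, and a ℤ-basis makes
-- membership in R decidable; since I is squeezed between integer multiples of
-- R, membership in I reduces to finitely many residues and is decidable too.
-- The same squeezing then exhibits finitely many generators of (I : I).
module Submission where

open import Defs
open import Algebra.Bundles using (CommutativeRing)
import Algebra.Properties.AbelianGroup as AbelianGroupProperties
import Algebra.Properties.CommutativeMonoid.Mult as CommutativeMonoidMult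
import Algebra.Properties.CommutativeSemigroup as CommutativeSemigroupProperties
import Algebra.Properties.Ring as RingProperties
import Algebra.Properties.Semiring.Mult as SemiringMult
import Algebra.Properties.Semiring.Sum as SemiringSum
open import Data.Fin.Base using (Fin; zero; suc)
open import Data.Fin.Properties using (all?)
open import Data.Integer.Base as ℤ using (ℤ; +_; -[1+_]; +[1+_]; 0ℤ)
import Data.Integer.Divisibility.Signed as ℤ
import Data.Integer.DivMod as ℤ
import Data.Integer.Properties as ℤ
open import Data.List.Base
  using (List; []; _∷_; _++_; allFin; cartesianProductWith; filter; length; lookup; map; tabulate; upTo)
open import Data.List.Membership.Propositional using (find; lose) renaming (_∈_ to _∈ˡ_)
open import Data.List.Membership.Propositional.Properties
open import Data.List.Relation.Unary.All as All using (All; []; _∷_)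
import Data.List.Relation.Unary.All.Properties as All
open import Data.List.Relation.Unary.AllPairs as AllPairs using (AllPairs; []; _∷_)
import Data.List.Relation.Unary.AllPairs.Properties as AllPairs
open import Data.List.Relation.Unary.Any as Any using (Any; here; any?)
open import Data.List.Relation.Unary.Any.Properties using (lookup-index)
open import Data.Nat.Base as ℕ using (ℕ; suc; NonZero)
import Data.Nat.Properties as ℕ
open import Data.Product.Base using (∃; ∃-syntax; _×_; _,_; proj₁; proj₂)
open import Data.Sum.Base using (inj₁; inj₂)
open import Data.Vec.Functional using (Vector; head; tail) renaming (_∷_ to _∷ᵛ_)
open import Function.Base using (_∘_; case_of_)
open import Level using (Level; _⊔_; Lift; lift)
open import Relation.Binary.Core using (Rel)
open import Relation.Binary.Definitions using (Symmetric)
open import Relation.Binary.PropositionalEquality.Core as ≡ using (_≡_; _≢_)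
import Relation.Binary.Reasoning.Setoid as SetoidReasoning
open import Relation.Nullary.Decidable using (map′)
open import Relation.Nullary.Negation.Core using (¬_; contradiction)
open import Relation.Unary using (Pred; Decidable; _∈_; _⊆_; _≐_)
open import Relation.Unary.Properties using (≐-sym; ≐-trans)

private
  variable
    a p q r ℓ₁ ℓ₂ : Level

-- Pairwise unrelated entries of lists.

AllPairs-lookup : {A : Set a} {R : Rel A r} {xs : List A} → Symmetric R → AllPairs R xs →
                  ∀ {i j} → i ≢ j → R (lookup xs i) (lookup xs j)
AllPairs-lookup R-sym (px ∷ pxs) {zero}  {zero}  i≢j = contradiction ≡.refl i≢j
AllPairs-lookup R-sym (px ∷ pxs) {zero}  {suc j} i≢j = All.lookup px (∈-lookup j)
AllPairs-lookup R-sym (px ∷ pxs) {suc i} {zero}  i≢j = R-sym (All.lookup px (∈-lookup i))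
AllPairs-lookup R-sym (px ∷ pxs) {suc i} {suc j} i≢j = AllPairs-lookup R-sym pxs (i≢j ∘ ≡.cong suc)

-- The product list consists of rows with a fixed first factor. Entries of different rows are
-- separated by `R` alone, whatever their second factors are; entries of one row are separated by
-- `T`. For products `W · J` this means: first the weak class of `W`, then the Picard class of `J`.
AllPairs-cartesianProductWith :
  {A : Set a} {P : Pred A p} {Q : Pred A q} {R : Rel A r} {T : Rel A ℓ₁} {U : Rel A ℓ₂} {xs ys : List A}
  (f : A → A → A) → All P xs → All Q ys → AllPairs R xs → AllPairs T ys →
  (∀ {x x′ y y′} → P x → P x′ → Q y → Q y′ → R x x′ → U (f x y) (f x′ y′)) →
  (∀ {x y y′} → P x → Q y → Q y′ → T y y′ → U (f x y) (f x y′)) →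
  AllPairs U (cartesianProductWith f xs ys)
AllPairs-cartesianProductWith f [] Qys [] Tys RU TU = []
AllPairs-cartesianProductWith {Q = Q} {T = T} {U} {x ∷ xs} {ys} f (Px ∷ Pxs) Qys (Rx ∷ Rxs) Tys RU TU =
  AllPairs.++⁺ (AllPairs.map⁺ (row Qys Tys))
    (AllPairs-cartesianProductWith f Pxs Qys Rxs Tys RU TU)
    (All.map⁺ (All.map between Qys))
  where
  row : ∀ {ys} → All Q ys → AllPairs T ys → AllPairs (λ y y′ → U (f x y) (f x y′)) ys
  row []         []         = []
  row (Qy ∷ Qys) (Ty ∷ Tys) = All.zipWith (λ (Qy′ , Tyy′) → TU Px Qy Qy′ Tyy′) (Qys , Ty) ∷ row Qys Tys

  between : ∀ {y} → Q y → All (U (f x y)) (cartesianProductWith f xs ys)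
  between Qy = All.tabulate λ z∈ → case ∈-cartesianProductWith⁻ f xs ys z∈ of λ where
    (x′ , y′ , x′∈ , y′∈ , ≡.refl) →
      RU Px (All.lookup Pxs x′∈) Qy (All.lookup Qys y′∈) (All.lookup Rx x′∈)

module _ {c ℓ} (K : CommutativeRing c ℓ) where

  open CommutativeRing K renaming (zero to *-zero)
  open Orders K
  open AbelianGroupProperties +-abelianGroup
    using () renaming (xyx⁻¹≈y to x+y-x≈y; ⁻¹-∙-comm to -‿+-comm; x≈y⇒x∙y⁻¹≈ε to x≈y⇒x-y≈0)
  open RingProperties ring using (-0#≈0#; -‿involutive; -‿distribˡ-*)
  open SemiringMult semiring using (×-congʳ; ×-congˡ; ×-homo-+; ×-assocˡ; ×-comm-*; ×-assoc-*)
    renaming (_×_ to infixr 8 _ℕ·_)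
  open CommutativeMonoidMult +-commutativeMonoid using (×-distrib-+)
  open SemiringSum semiring using (sum; sum-cong-≋; sum-replicate-zero; ∑-distrib-+; *-distribˡ-sum)
  module +-Props = CommutativeSemigroupProperties +-commutativeSemigroup
  module *-Props = CommutativeSemigroupProperties *-commutativeSemigroup
  open SetoidReasoning setoid

  -- Integer multiples

  ℕ·≈*ˡ : ∀ n x → n ℕ· x ≈ (n ℕ· 1#) * x
  ℕ·≈*ˡ n x = trans (×-congʳ n (sym (*-identityˡ x))) (sym (×-assoc-* n 1# x))

  ℕ·-neg : ∀ n x → n ℕ· (- x) ≈ - (n ℕ· x)
  ℕ·-neg ℕ.zero  x = sym -0#≈0#
  ℕ·-neg (suc n) x = trans (+-congˡ (ℕ·-neg n x)) (-‿+-comm _ _)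

  ℤ·-congˡ : ∀ {z w} x → z ≡ w → z ℤ· x ≈ w ℤ· x
  ℤ·-congˡ x ≡.refl = refl

  ℤ·≈*ˡ : ∀ z x → z ℤ· x ≈ (z ℤ· 1#) * x
  ℤ·≈*ˡ (+ n)    x = ℕ·≈*ˡ n x
  ℤ·≈*ˡ -[1+ n ] x = trans (-‿cong (ℕ·≈*ˡ (suc n) x)) (-‿distribˡ-* _ x)

  ℤ·-homo-neg : ∀ x z → (ℤ.- z) ℤ· x ≈ - (z ℤ· x)
  ℤ·-homo-neg x (+ 0)    = sym -0#≈0#
  ℤ·-homo-neg x +[1+ n ] = refl
  ℤ·-homo-neg x -[1+ n ] = sym (-‿involutive _)

  ℤ·-homo-⊖ : ∀ x m n → (m ℤ.⊖ n) ℤ· x ≈ m ℕ· x + - (n ℕ· x)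
  ℤ·-homo-⊖ x ℕ.zero  ℕ.zero  = sym (trans (+-congˡ -0#≈0#) (+-identityˡ _))
  ℤ·-homo-⊖ x (suc m) ℕ.zero  = sym (trans (+-congˡ -0#≈0#) (+-identityʳ _))
  ℤ·-homo-⊖ x ℕ.zero  (suc n) = sym (+-identityˡ _)
  ℤ·-homo-⊖ x (suc m) (suc n) = begin
    (suc m ℤ.⊖ suc n) ℤ· x             ≈⟨ ℤ·-congˡ x (ℤ.[1+m]⊖[1+n]≡m⊖n m n) ⟩
    (m ℤ.⊖ n) ℤ· x                     ≈⟨ ℤ·-homo-⊖ x m n ⟩
    m ℕ· x + - (n ℕ· x)                ≈⟨ +-identityˡ _ ⟨
    0# + (m ℕ· x + - (n ℕ· x))         ≈⟨ +-congʳ (-‿inverseʳ x) ⟨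
    (x + - x) + (m ℕ· x + - (n ℕ· x))  ≈⟨ +-Props.interchange _ _ _ _ ⟩
    (x + m ℕ· x) + (- x + - (n ℕ· x))  ≈⟨ +-congˡ (-‿+-comm _ _) ⟩
    (x + m ℕ· x) + - (x + n ℕ· x)      ∎

  ℤ·-homo-+ : ∀ x z w → (z ℤ.+ w) ℤ· x ≈ z ℤ· x + w ℤ· x
  ℤ·-homo-+ x (+ m)    (+ n)    = ×-homo-+ x m n
  ℤ·-homo-+ x (+ m)    -[1+ n ] = ℤ·-homo-⊖ x m (suc n)
  ℤ·-homo-+ x -[1+ m ] (+ n)    = trans (ℤ·-homo-⊖ x n (suc m)) (+-comm _ _)
  ℤ·-homo-+ x -[1+ m ] -[1+ n ] = begin
    - (suc (suc (m ℕ.+ n)) ℕ· x)        ≈⟨ -‿cong (×-congˡ (≡.cong suc (ℕ.+-suc m n))) ⟨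
    - ((suc m ℕ.+ suc n) ℕ· x)          ≈⟨ -‿cong (×-homo-+ x (suc m) (suc n)) ⟩
    - (suc m ℕ· x + suc n ℕ· x)         ≈⟨ -‿+-comm _ _ ⟨
    - (suc m ℕ· x) + - (suc n ℕ· x)     ∎

  ℤ·-homo-* : ∀ x z n → (z ℤ.* + n) ℤ· x ≈ n ℕ· (z ℤ· x)
  ℤ·-homo-* x (+ m) n = begin
    (+ m ℤ.* + n) ℤ· x  ≈⟨ ℤ·-congˡ x (ℤ.pos-* m n) ⟨
    (m ℕ.* n) ℕ· x      ≈⟨ ×-congˡ (ℕ.*-comm m n) ⟩
    (n ℕ.* m) ℕ· x      ≈⟨ ×-assocˡ x n m ⟨
    n ℕ· m ℕ· x         ∎
  ℤ·-homo-* x -[1+ m ] n = begin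
    (-[1+ m ] ℤ.* + n) ℤ· x      ≈⟨ ℤ·-congˡ x (ℤ.neg-distribˡ-* +[1+ m ] (+ n)) ⟨
    (ℤ.- (+[1+ m ] ℤ.* + n)) ℤ· x ≈⟨ ℤ·-homo-neg x (+[1+ m ] ℤ.* + n) ⟩
    - ((+[1+ m ] ℤ.* + n) ℤ· x)  ≈⟨ -‿cong (ℤ·-homo-* x +[1+ m ] n) ⟩
    - (n ℕ· suc m ℕ· x)          ≈⟨ ℕ·-neg n _ ⟨
    n ℕ· (- (suc m ℕ· x))        ∎

  ℕ·-distrib-sum : ∀ m {n} (t : Vector Carrier n) → m ℕ· sum t ≈ sum (λ i → m ℕ· t i)
  ℕ·-distrib-sum m {ℕ.zero} t = ℕ·-zero m
    where
    ℕ·-zero : ∀ m → m ℕ· 0# ≈ 0#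
    ℕ·-zero m = trans (ℕ·≈*ˡ m 0#) (zeroʳ _)
  ℕ·-distrib-sum m {suc n} t = trans (×-distrib-+ _ _ m) (+-congˡ (ℕ·-distrib-sum m (tail t)))

  sum-zero : ∀ {n} (g : Vector Carrier n) → sum (λ i → 0# * g i) ≈ 0#
  sum-zero {n} g = trans (sum-cong-≋ (λ i → zeroˡ (g i))) (sum-replicate-zero n)

  sum-neg : ∀ {n} (t : Vector Carrier n) → sum (λ i → - t i) ≈ - sum t
  sum-neg {ℕ.zero} t = sym -0#≈0#
  sum-neg {suc n}  t = trans (+-congˡ (sum-neg (tail t))) (-‿+-comm _ _)

  -- Submonoids, spans and products

  -- The part shared by subrings, ideals, colons, products and spans. No ring of scalars is fixed,
  -- so that the same target can receive maps from R-modules and from S-modules.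
  record IsSubmonoid {p} (U : Pred Carrier p) : Set (c ⊔ ℓ ⊔ p) where
    field
      resp     : ∀ {x y} → x ≈ y → x ∈ U → y ∈ U
      0-mem    : 0# ∈ U
      +-closed : ∀ {x y} → x ∈ U → y ∈ U → (x + y) ∈ U

    sum-closed : ∀ {n} {t : Vector Carrier n} → (∀ i → t i ∈ U) → sum t ∈ U
    sum-closed {ℕ.zero} t∈ = 0-mem
    sum-closed {suc n}  t∈ = +-closed (t∈ zero) (sum-closed (t∈ ∘ suc))

    ℕ·-closed : ∀ n {x} → x ∈ U → (n ℕ· x) ∈ U
    ℕ·-closed ℕ.zero  x∈ = 0-mem
    ℕ·-closed (suc n) x∈ = +-closed x∈ (ℕ·-closed n x∈)

  open IsSubmonoid

  -- The preimage of `U` under multiplication by `z`. Feeding it to `·-least` or `Span-least`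
  -- reduces an inclusion of the form z A ⊆ U to a check on generators.
  scaling-isSubmonoid : ∀ {p} {U : Pred Carrier p} z → IsSubmonoid U → IsSubmonoid (λ x → (z * x) ∈ U)
  scaling-isSubmonoid z U = record
    { resp     = λ x≈y → U .resp (*-congˡ x≈y)
    ; 0-mem    = U .resp (sym (zeroʳ z)) (U .0-mem)
    ; +-closed = λ zx∈ zy∈ → U .resp (sym (distribˡ z _ _)) (U .+-closed zx∈ zy∈)
    }

  Closed : Subset → Subset → Set (c ⊔ ℓ)
  Closed R U = ∀ {r x} → r ∈ R → x ∈ U → (r * x) ∈ U

  FinitelyGenerated : Subset → Subset → Set (c ⊔ ℓ)
  FinitelyGenerated R I = ∃[ n ] ∃ λ (g : Vector Carrier n) → I ≐ Span R g

  Full : Subset → Set (c ⊔ ℓ)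
  Full U = ∀ x → ∃[ m ] NonZero m × (m ℕ· x) ∈ U

  module _ (A B : Subset) where

    ·-least : ∀ {p} {U : Pred Carrier p} → IsSubmonoid U →
              (∀ {a b} → a ∈ A → b ∈ B → (a * b) ∈ U) → ∀ {x} → x ∈ A · B → x ∈ U
    ·-least U ab∈ (n , a , b , a∈ , b∈ , x≈) =
      U .resp (sym x≈) (sum-closed U (λ i → ab∈ (a∈ i) (b∈ i)))

    ·-intro : ∀ {a b} → a ∈ A → b ∈ B → (a * b) ∈ A · B
    ·-intro a∈ b∈ =
      1 , (λ _ → _) , (λ _ → _) , (λ _ → a∈) , (λ _ → b∈) , sym (+-identityʳ _)

    ·-isSubmonoid : IsSubmonoid (A · B)
    ·-isSubmonoid = record
      { resp     = λ x≈y (n , a , b , a∈ , b∈ , x≈) → n , a , b , a∈ , b∈ , trans (sym x≈y) x≈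
      ; 0-mem    = 0 , (λ ()) , (λ ()) , (λ ()) , (λ ()) , refl
      ; +-closed = λ (n , a , b , a∈ , b∈ , x≈) y∈ → append n a b a∈ b∈ x≈ y∈
      }
      where
      append : ∀ n (a b : Vector Carrier n) → (∀ i → a i ∈ A) → (∀ i → b i ∈ B) →
               ∀ {x y} → x ≈ sum (λ i → a i * b i) → y ∈ A · B → (x + y) ∈ A · B
      append ℕ.zero a b a∈ b∈ x≈ (m , a′ , b′ , a′∈ , b′∈ , y≈) =
        m , a′ , b′ , a′∈ , b′∈ , trans (+-congʳ x≈) (trans (+-identityˡ _) y≈)
      append (suc n) a b a∈ b∈ x≈ y∈
        with m , a′ , b′ , a′∈ , b′∈ , y≈ ← append n (tail a) (tail b) (a∈ ∘ suc) (b∈ ∘ suc) refl y∈ =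
        suc m , head a ∷ᵛ a′ , head b ∷ᵛ b′ ,
        (λ { zero → a∈ zero ; (suc i) → a′∈ i }) , (λ { zero → b∈ zero ; (suc i) → b′∈ i }) ,
        trans (+-congʳ x≈) (trans (+-assoc _ _ _) (+-congˡ y≈))

    ·-closed : ∀ {R} → Closed R A → Closed R (A · B)
    ·-closed A-closed r∈ =
      ·-least (scaling-isSubmonoid _ ·-isSubmonoid) λ a∈ b∈ →
        ·-isSubmonoid .resp (*-assoc _ _ _) (·-intro (A-closed r∈ a∈) b∈)

    ·-full : Full A → Full B → Full (A · B)
    ·-full A-full B-full x
      with m , m≢0 , mx∈ ← A-full x | n , n≢0 , n1∈ ← B-full 1# =
      m ℕ.* n , ℕ.m*n≢0 m n {{m≢0}} {{n≢0}} , ·-isSubmonoid .resp eq (·-intro mx∈ n1∈)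
      where
      eq : (m ℕ· x) * (n ℕ· 1#) ≈ (m ℕ.* n) ℕ· x
      eq = begin
        (m ℕ· x) * (n ℕ· 1#)   ≈⟨ ×-assoc-* m x _ ⟩
        m ℕ· (x * (n ℕ· 1#))   ≈⟨ ×-congʳ m (×-comm-* n x 1#) ⟩
        m ℕ· n ℕ· (x * 1#)     ≈⟨ ×-assocˡ _ m n ⟩
        (m ℕ.* n) ℕ· (x * 1#)  ≈⟨ ×-congʳ (m ℕ.* n) (*-identityʳ x) ⟩
        (m ℕ.* n) ℕ· x         ∎

  module _ (R : Subset) where

    Span-least : ∀ {p} {U : Pred Carrier p} {n} (g : Vector Carrier n) → IsSubmonoid U →
                 (∀ {r} i → r ∈ R → (r * g i) ∈ U) → ∀ {x} → x ∈ Span R g → x ∈ U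
    Span-least g U rg∈ (r , r∈ , x≈) = U .resp (sym x≈) (sum-closed U (λ i → rg∈ i (r∈ i)))

    Span-∷ : ∀ {n} (g : Vector Carrier (suc n)) {r y} →
             r ∈ R → y ∈ Span R (tail g) → (r * head g + y) ∈ Span R g
    Span-∷ g r∈ (s , s∈ , y≈) =
      _ ∷ᵛ s , (λ { zero → r∈ ; (suc i) → s∈ i }) , +-congˡ y≈

    module _ (R-sub : IsSubmonoid R) where

      Span-isSubmonoid : ∀ {n} (g : Vector Carrier n) → IsSubmonoid (Span R g)
      Span-isSubmonoid g = record
        { resp     = λ x≈y (r , r∈ , x≈) → r , r∈ , trans (sym x≈y) x≈
        ; 0-mem    = (λ _ → 0#) , (λ _ → R-sub .0-mem) , sym (sum-zero g)
        ; +-closed = λ (r , r∈ , x≈) (s , s∈ , y≈) →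
            (λ i → r i + s i) , (λ i → R-sub .+-closed (r∈ i) (s∈ i)) ,
            trans (+-cong x≈ y≈) (sym (sum-distribʳ r s g))
        }
        where
        sum-distribʳ : ∀ {n} (r s g : Vector Carrier n) →
                       sum (λ i → (r i + s i) * g i) ≈ sum (λ i → r i * g i) + sum (λ i → s i * g i)
        sum-distribʳ r s g = trans (sum-cong-≋ (λ i → distribʳ (g i) (r i) (s i)))
          (∑-distrib-+ (λ i → r i * g i) (λ i → s i * g i))

      Span-scaled-generator : ∀ {n} (g : Vector Carrier n) {r} → r ∈ R → ∀ i → (r * g i) ∈ Span R g
      Span-scaled-generator g r∈ zero =
        Span-isSubmonoid g .resp (+-identityʳ _) (Span-∷ g r∈ (Span-isSubmonoid (tail g) .0-mem))
      Span-scaled-generator g r∈ (suc i) =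
        Span-isSubmonoid g .resp (trans (+-congʳ (zeroˡ _)) (+-identityˡ _))
          (Span-∷ g (R-sub .0-mem) (Span-scaled-generator (tail g) r∈ i))

  subring-isSubmonoid : ∀ {R} → IsSubring R → IsSubmonoid R
  subring-isSubmonoid R = record { IsSubring R }

  ideal-isSubmonoid : ∀ {R I} → IsFractionalIdeal R I → IsSubmonoid I
  ideal-isSubmonoid I = record { IsFractionalIdeal I }

  open IsSubring using (1-mem; neg-mem) renaming (*-closed to R-*-closed)

  module _ {R : Subset} (R-ring : IsSubring R) where

    private R-sub = subring-isSubmonoid R-ring

    Span-closed : ∀ {n} (g : Vector Carrier n) → Closed R (Span R g)
    Span-closed g r∈ = Span-least R g (scaling-isSubmonoid _ (Span-isSubmonoid R R-sub g)) λ i s∈ →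
      Span-isSubmonoid R R-sub g .resp (*-assoc _ _ _)
        (Span-scaled-generator R R-sub g (R-*-closed R-ring r∈ s∈) i)

    generator-∈-Span : ∀ {n} (g : Vector Carrier n) i → g i ∈ Span R g
    generator-∈-Span g i = Span-isSubmonoid R R-sub g .resp (*-identityˡ _)
      (Span-scaled-generator R R-sub g (1-mem R-ring) i)

  module _ {R : Subset} (R-ring : IsSubring R) where

    private R-sub = subring-isSubmonoid R-ring

    lookup-∈-Span : ∀ {xs x} → x ∈ˡ xs → x ∈ Span R (lookup xs)
    lookup-∈-Span {xs} x∈ = ≡.subst (_∈ Span R (lookup xs)) (≡.sym (lookup-index x∈))
      (generator-∈-Span R-ring (lookup xs) (Any.index x∈))

    neg-closed : ∀ {U} → IsSubmonoid U → Closed R U → ∀ {x} → x ∈ U → (- x) ∈ U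
    neg-closed U U-closed x∈ =
      U .resp (trans (sym (-‿distribˡ-* _ _)) (-‿cong (*-identityˡ _)))
        (U-closed (neg-mem R-ring (1-mem R-ring)) x∈)

    list-finitelyGenerated : ∀ {U} → IsSubmonoid U → Closed R U → (xs : List Carrier) →
                             (∀ {x} → x ∈ˡ xs → x ∈ U) → U ⊆ Span R (lookup xs) →
                             FinitelyGenerated R U
    list-finitelyGenerated U U-closed xs xs⊆U U⊆ =
      length xs , lookup xs , U⊆ ,
      Span-least R (lookup xs) U (λ i r∈ → U-closed r∈ (xs⊆U (∈-lookup i)))

    -- The products of generators suffice even though `B` is generated over `S` and only
    -- coefficients from `R` are allowed: in a (s hⱼ) the coefficient s is absorbed into `A`, which
    -- is stable under `S`, and s a is then expanded over `R`.
    ·-finitelyGenerated : ∀ {S A B} → IsSubring S → IsSubmonoid A → Closed R A → Closed S A →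
                          FinitelyGenerated R A → FinitelyGenerated S B →
                          FinitelyGenerated R (A · B)
    ·-finitelyGenerated {S} {A} {B} S-ring A-sub A-closed A-S (m , g , A⊆ , ⊆A) (n , h , B⊆ , ⊆B) =
      list-finitelyGenerated (·-isSubmonoid A B) (·-closed A B A-closed) gens gens⊆ ⊆Span
      where
      gens = cartesianProductWith _*_ (tabulate g) (tabulate h)

      span = Span-isSubmonoid R R-sub (lookup gens)

      g∈ : ∀ i → g i ∈ A
      g∈ i = ⊆A (generator-∈-Span R-ring g i)

      h∈ : ∀ j → h j ∈ B
      h∈ j = ⊆B (generator-∈-Span S-ring h j)

      gens⊆ : ∀ {x} → x ∈ˡ gens → x ∈ A · B
      gens⊆ x∈ with ∈-cartesianProductWith⁻ _*_ (tabulate g) (tabulate h) x∈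
      ... | a , b , a∈ , b∈ , ≡.refl with ∈-tabulate⁻ {f = g} a∈ | ∈-tabulate⁻ {f = h} b∈
      ... | i , ≡.refl | j , ≡.refl = ·-intro A B (g∈ i) (h∈ j)

      gh∈ : ∀ i j → (g i * h j) ∈ Span R (lookup gens)
      gh∈ i j = lookup-∈-Span (∈-cartesianProductWith⁺ _*_ (∈-tabulate⁺ {f = g} i) (∈-tabulate⁺ {f = h} j))

      ha∈ : ∀ {a} j → a ∈ A → (h j * a) ∈ Span R (lookup gens)
      ha∈ j a∈ = Span-least R g (scaling-isSubmonoid (h j) span)
        (λ i r∈ → span .resp (*-Props.x∙yz≈z∙xy _ _ _) (Span-closed R-ring (lookup gens) r∈ (gh∈ i j)))
        (A⊆ a∈)

      ⊆Span : A · B ⊆ Span R (lookup gens)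
      ⊆Span = ·-least A B span λ {a} a∈ b∈ →
        Span-least S h (scaling-isSubmonoid a span)
          (λ j s∈ → span .resp (*-Props.x∙yz≈z∙yx _ _ _) (ha∈ j (A-S s∈ a∈)))
          (B⊆ b∈)

  ·-isFractionalIdeal : ∀ {R S A B} → IsSubring R → IsSubring S → Closed S A →
                        IsFractionalIdeal R A → IsFractionalIdeal S B →
                        IsFractionalIdeal R (A · B)
  ·-isFractionalIdeal {A = A} {B} R-ring S-ring A-S A-ideal B-ideal = record
    { resp              = ·-isSubmonoid A B .resp
    ; 0-mem             = ·-isSubmonoid A B .0-mem
    ; +-closed          = ·-isSubmonoid A B .+-closed
    ; *-closed          = ·-closed A B (A.*-closed)
    ; finitelyGenerated = ·-finitelyGenerated R-ring S-ring (ideal-isSubmonoid A-ideal) A.*-closed A-S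
                            A.finitelyGenerated B.finitelyGenerated
    ; full              = ·-full A B A.full B.full
    }
    where
    module A = IsFractionalIdeal A-ideal
    module B = IsFractionalIdeal B-ideal

  -- Common integer multiples and colons of ideals.

  common-multiple : ∀ {U : Subset} → IsSubmonoid U → Full U → ∀ {n} (g : Vector Carrier n) →
                    ∃[ m ] NonZero m × (∀ i → (m ℕ· g i) ∈ U)
  common-multiple U U-full {ℕ.zero} g = 1 , _ , λ ()
  common-multiple U U-full {suc n} g
    with m , m≢0 , m∈ ← U-full (head g) | k , k≢0 , k∈ ← common-multiple U U-full (tail g) =
    m ℕ.* k , ℕ.m*n≢0 m k {{m≢0}} {{k≢0}} , λ where
      zero    → U .resp (trans (×-assocˡ _ k m) (×-congˡ (ℕ.*-comm k m))) (ℕ·-closed U k m∈)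
      (suc i) → U .resp (×-assocˡ _ m k) (ℕ·-closed U m (k∈ i))

  ∶-isSubmonoid : ∀ A B → IsSubmonoid A → IsSubmonoid (A ∶ B)
  ∶-isSubmonoid A B A-sub = record
    { resp     = λ x≈y x∈ b∈ → A-sub .resp (*-congʳ x≈y) (x∈ b∈)
    ; 0-mem    = λ b∈ → A-sub .resp (sym (zeroˡ _)) (A-sub .0-mem)
    ; +-closed = λ x∈ y∈ b∈ → A-sub .resp (sym (distribʳ _ _ _)) (A-sub .+-closed (x∈ b∈) (y∈ b∈))
    }

  ∶-closed : ∀ A B {S} → IsSubmonoid A → Closed S A → Closed S (A ∶ B)
  ∶-closed A B A-sub A-closed s∈ x∈ b∈ = A-sub .resp (sym (*-assoc _ _ _)) (A-closed s∈ (x∈ b∈))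

  -- One integer m brings x gᵢ into `A` for all of the finitely many generators gᵢ of `B`, and then
  -- m x B ⊆ A.
  ∶-full : ∀ A B {R} → IsSubmonoid A → Closed R A → Full A → FinitelyGenerated R B → Full (A ∶ B)
  ∶-full A B {R} A-sub A-closed A-full (n , g , B⊆ , _) x
    with m , m≢0 , mxg∈ ← common-multiple A-sub A-full (λ i → x * g i) =
    m , m≢0 , λ y∈ → Span-least R g (scaling-isSubmonoid (m ℕ· x) A-sub)
      (λ {r} i r∈ → A-sub .resp
        (trans (*-congˡ (sym (×-assoc-* m x (g i)))) (*-Props.x∙yz≈y∙xz r (m ℕ· x) (g i)))
        (A-closed r∈ (mxg∈ i)))
      (B⊆ y∈)

  -- Residues modulo an integer

  -- A constructive form of the finiteness of A / d A: an explicit list meeting every coset. A coset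
  -- may be met several times, so no decidable equality is involved.
  Residues : ℕ → Subset → Set (c ⊔ ℓ)
  Residues d A = ∃ λ (es : List Carrier) → (∀ {e} → e ∈ˡ es → e ∈ A) ×
                 (∀ {x} → x ∈ A → ∃[ e ] e ∈ˡ es × (∃[ y ] y ∈ A × x ≈ e + d ℕ· y))

  Residues-≐ : ∀ d {A B} → A ≐ B → Residues d A → Residues d B
  Residues-≐ d (A⊆B , B⊆A) (es , es⊆A , divide) = es , (λ e∈ → A⊆B (es⊆A e∈)) , λ x∈ →
    let e , e∈ , y , y∈ , x≈ = divide (B⊆A x∈) in e , e∈ , y , A⊆B y∈ , x≈

  -- Each coefficient is divided by d separately, so all combinations of the generators with
  -- coefficients from the list of residues of `A` suffice. The generators may satisfy relations,
  -- since repetitions are allowed.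
  residues-Span : ∀ d {A} → Residues d A → ∀ {n} (g : Vector Carrier n) → Residues d (Span A g)
  -- The empty span is the zero module; its only residue is 0, with quotient 0.
  residues-Span d _ {ℕ.zero} g =
    0# ∷ [] , (λ { (here ≡.refl) → (λ ()) , (λ ()) , refl }) , λ (_ , _ , x≈) →
    0# , here ≡.refl , 0# , ((λ ()) , (λ ()) , refl) ,
    trans x≈ (sym (trans (+-identityˡ _) (trans (ℕ·≈*ˡ d 0#) (zeroʳ _))))
  residues-Span d {A} A-residues@(es , es⊆A , divide) {suc n} g
    with fs , fs⊆ , divide′ ← residues-Span d {A = A} A-residues (tail g) = list , list⊆ , divide″
    where
    term : Carrier → Carrier → Carrier
    term e f = e * head g + f

    list = cartesianProductWith term es fs

    list⊆ : ∀ {e} → e ∈ˡ list → e ∈ Span A g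
    list⊆ e∈ with ∈-cartesianProductWith⁻ term es fs e∈
    ... | a , b , a∈ , b∈ , ≡.refl = Span-∷ A g (es⊆A a∈) (fs⊆ b∈)

    divide″ : ∀ {x} → x ∈ Span A g → ∃[ e ] e ∈ˡ list × (∃[ y ] y ∈ Span A g × x ≈ e + d ℕ· y)
    divide″ {x} (r , r∈ , x≈)
      with e , e∈ , y , y∈ , r₀≈ ← divide (r∈ zero)
         | f , f∈ , z , z∈ , s≈ ← divide′ (tail r , r∈ ∘ suc , refl) =
      term e f , ∈-cartesianProductWith⁺ term e∈ f∈ , term y z , Span-∷ A g y∈ z∈ , (begin
        x                                                        ≈⟨ x≈ ⟩
        head r * head g + _                                      ≈⟨ +-cong (*-congʳ r₀≈) s≈ ⟩
        (e + d ℕ· y) * head g + (f + d ℕ· z)                     ≈⟨ +-congʳ (distribʳ _ _ _) ⟩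
        (e * head g + (d ℕ· y) * head g) + (f + d ℕ· z)          ≈⟨ +-Props.interchange _ _ _ _ ⟩
        (e * head g + f) + ((d ℕ· y) * head g + d ℕ· z)          ≈⟨ +-congˡ (+-congʳ (×-assoc-* d y _)) ⟩
        (e * head g + f) + (d ℕ· (y * head g) + d ℕ· z)          ≈⟨ +-congˡ (×-distrib-+ _ _ d) ⟨
        (e * head g + f) + d ℕ· (y * head g + z)                 ∎)

  -- U is generated by the multiples d h of the generators of the larger module
  -- together with the residues modulo d that lie in U.
  sandwiched-finitelyGenerated :
    ∀ {R U : Subset} → IsSubring R → IsSubmonoid U → Closed R U → Decidable (_∈ U) →
    ∀ d {n} (h : Vector Carrier n) → Residues d (Span R h) →
    (∀ i → (d ℕ· h i) ∈ U) → U ⊆ Span R h → FinitelyGenerated R U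
  sandwiched-finitelyGenerated {R} {U} R-ring U-sub U-closed U? d h (es , _ , divide) dh∈ U⊆H =
    list-finitelyGenerated R-ring U-sub U-closed gens gens⊆U U⊆Span
    where
    dh : Vector Carrier _
    dh i = d ℕ· h i

    gens = tabulate dh ++ filter U? es

    span = Span-isSubmonoid R (subring-isSubmonoid R-ring) (lookup gens)

    gens⊆U : ∀ {x} → x ∈ˡ gens → x ∈ U
    gens⊆U x∈ with ∈-++⁻ (tabulate dh) x∈
    ... | inj₁ x∈dh with i , ≡.refl ← ∈-tabulate⁻ {f = dh} x∈dh = dh∈ i
    ... | inj₂ x∈es = proj₂ (∈-filter⁻ U? {xs = es} x∈es)

    Span⊆U : Span R (lookup gens) ⊆ U
    Span⊆U = Span-least R (lookup gens) U-sub (λ i r∈ → U-closed r∈ (gens⊆U (∈-lookup i)))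

    dH⊆Span : ∀ {y} → y ∈ Span R h → (d ℕ· y) ∈ Span R (lookup gens)
    dH⊆Span {y} y∈ = span .resp (sym (ℕ·≈*ˡ d y))
      (Span-least R h (scaling-isSubmonoid (d ℕ· 1#) span)
        (λ {r} i r∈ → span .resp (begin
          r * (d ℕ· h i)            ≈⟨ *-congˡ (ℕ·≈*ˡ d (h i)) ⟩
          r * ((d ℕ· 1#) * h i)     ≈⟨ *-Props.x∙yz≈y∙xz _ _ _ ⟩
          (d ℕ· 1#) * (r * h i)     ∎)
          (Span-closed R-ring (lookup gens) r∈
            (lookup-∈-Span R-ring (∈-++⁺ˡ (∈-tabulate⁺ {f = dh} i)))))
        y∈)

    U⊆Span : U ⊆ Span R (lookup gens)
    U⊆Span {x} x∈ with e , e∈ , y , y∈ , x≈ ← divide (U⊆H x∈) =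
      span .resp (sym x≈) (span .+-closed
        (lookup-∈-Span R-ring (∈-++⁺ʳ (tabulate dh) (∈-filter⁺ U? e∈ e∈U)))
        (dH⊆Span y∈))
      where
      -- The residue passes the filter because it is the difference of x and d y, both of which lie
      -- in `U`.
      e∈U : e ∈ U
      e∈U = U-sub .resp
        (begin
          x - d ℕ· y                   ≈⟨ +-congʳ x≈ ⟩
          (e + d ℕ· y) - d ℕ· y        ≈⟨ +-assoc _ _ _ ⟩
          e + (d ℕ· y - d ℕ· y)        ≈⟨ +-congˡ (-‿inverseʳ _) ⟩
          e + 0#                       ≈⟨ +-identityʳ e ⟩
          e                            ∎)
        (U-sub .+-closed x∈ (neg-closed R-ring U-sub U-closed (Span⊆U (dH⊆Span y∈))))

  -- The image of ℤ in K, lifted to the level of `Subset`, so that a ℤ-span becomes a `Span` and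
  -- `residues-Span` applies to the order itself.
  ℤ·1 : Subset
  ℤ·1 x = Lift c (∃[ z ] x ≈ z ℤ· 1#)

  residues-ℤ·1 : ∀ d → .{{NonZero d}} → Residues d ℤ·1
  residues-ℤ·1 d = map (_ℕ· 1#) (upTo d) , ⊆ℤ·1 , divide
    where
    ⊆ℤ·1 : ∀ {e} → e ∈ˡ map (_ℕ· 1#) (upTo d) → e ∈ ℤ·1
    ⊆ℤ·1 e∈ with n , _ , ≡.refl ← ∈-map⁻ (_ℕ· 1#) e∈ = lift (+ n , refl)

    divide : ∀ {x} → x ∈ ℤ·1 →
             ∃[ e ] e ∈ˡ map (_ℕ· 1#) (upTo d) × (∃[ y ] y ∈ ℤ·1 × x ≈ e + d ℕ· y)
    divide {x} (lift (z , x≈)) =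
      _ , ∈-map⁺ (_ℕ· 1#) (∈-upTo⁺ (ℤ.n%ℕd<d z d)) , (z ℤ./ℕ d) ℤ· 1# , lift (z ℤ./ℕ d , refl) , (begin
        x                                                  ≈⟨ x≈ ⟩
        z ℤ· 1#                                            ≈⟨ ℤ·-congˡ 1# (ℤ.a≡a%ℕn+[a/ℕn]*n z d) ⟩
        (+ (z ℤ.%ℕ d) ℤ.+ (z ℤ./ℕ d) ℤ.* + d) ℤ· 1#        ≈⟨ ℤ·-homo-+ 1# (+ (z ℤ.%ℕ d)) ((z ℤ./ℕ d) ℤ.* + d) ⟩
        (z ℤ.%ℕ d) ℕ· 1# + ((z ℤ./ℕ d) ℤ.* + d) ℤ· 1#      ≈⟨ +-congˡ (ℤ·-homo-* 1# (z ℤ./ℕ d) d) ⟩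
        (z ℤ.%ℕ d) ℕ· 1# + d ℕ· (z ℤ./ℕ d) ℤ· 1#           ∎)

  ℤ-Span≐Span : ∀ {n} (b : Vector Carrier n) → Span ℤ·1 b ≐ ℤ-Span b
  ℤ-Span≐Span b =
    (λ (r , r∈ , x≈) → (λ i → proj₁ (Lift.lower (r∈ i))) , trans x≈ (sum-cong-≋ λ i →
      trans (*-congʳ (proj₂ (Lift.lower (r∈ i)))) (sym (ℤ·≈*ˡ (proj₁ (Lift.lower (r∈ i))) (b i))))) ,
    (λ (z , x≈) → (λ i → z i ℤ· 1#) , (λ i → lift (z i , refl)) ,
      trans x≈ (sum-cong-≋ λ i → ℤ·≈*ˡ (z i) (b i)))

  inverse-cancel : ∀ {α β} x → α * β ≈ 1# → β * (α * x) ≈ x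
  inverse-cancel {α} {β} x αβ≈1 =
    trans (sym (*-assoc β α x)) (trans (*-congʳ (trans (*-comm β α) αβ≈1)) (*-identityˡ x))

  inverse-cancel′ : ∀ {α β} x → α * β ≈ 1# → α * (β * x) ≈ x
  inverse-cancel′ x αβ≈1 = inverse-cancel x (trans (*-comm _ _) αβ≈1)

  -- Coordinates, denominators and decidable membership for the order.

  module OrderProperties {R : Subset} (R-order : IsOrder R) (tq : IsTotalQuotientRing R) where

    open IsOrder R-order renaming (isSubring to R-ring)
    open IsTotalQuotientRing tq

    R-sub = subring-isSubmonoid R-ring

    residues-R : ∀ d → .{{NonZero d}} → Residues d R
    residues-R d = Residues-≐ d (≐-trans (ℤ-Span≐Span basis) (≐-sym spanning))
      (residues-Span d {A = ℤ·1} (residues-ℤ·1 d) basis)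

    coordinates-unique : ∀ (z w : Vector ℤ rank) → sum (λ i → z i ℤ· basis i) ≈ sum (λ i → w i ℤ· basis i) →
                         ∀ i → z i ≡ w i
    coordinates-unique z w z≈w i = ℤ.i-j≡0⇒i≡j (z i) (w i) (independent (λ j → z j ℤ.- w j) eq i)
      where
      eq : sum (λ j → (z j ℤ.- w j) ℤ· basis j) ≈ 0#
      eq = begin
        sum (λ j → (z j ℤ.- w j) ℤ· basis j)
          ≈⟨ sum-cong-≋ (λ j → trans (ℤ·-homo-+ (basis j) (z j) (ℤ.- w j))
                                     (+-congˡ (ℤ·-homo-neg (basis j) (w j)))) ⟩
        sum (λ j → z j ℤ· basis j + - (w j ℤ· basis j))
          ≈⟨ ∑-distrib-+ (λ j → z j ℤ· basis j) (λ j → - (w j ℤ· basis j)) ⟩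
        sum (λ j → z j ℤ· basis j) + sum (λ j → - (w j ℤ· basis j))
          ≈⟨ +-congˡ (sum-neg (λ j → w j ℤ· basis j)) ⟩
        sum (λ j → z j ℤ· basis j) + - sum (λ j → w j ℤ· basis j)
          ≈⟨ x≈y⇒x-y≈0 z≈w ⟩
        0#  ∎

    ℕ·-coordinates : ∀ m (z : Vector ℤ rank) →
                     m ℕ· sum (λ i → z i ℤ· basis i) ≈ sum (λ i → (z i ℤ.* + m) ℤ· basis i)
    ℕ·-coordinates m z = trans (ℕ·-distrib-sum m (λ i → z i ℤ· basis i))
      (sum-cong-≋ λ i → sym (ℤ·-homo-* (basis i) (z i) m))

    ℕ-mem : ∀ m → (m ℕ· 1#) ∈ R
    ℕ-mem m = ℕ·-closed R-sub m (1-mem R-ring)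

    -- Multiplication by m multiplies the coordinates in the ℤ-basis by m, hence is injective on
    -- `R`; so m is a non-zero-divisor of `R` and becomes invertible in K. In effect K is a
    -- ℚ-algebra.
    ℕ-unit : ∀ m → .{{NonZero m}} → IsUnit (m ℕ· 1#)
    ℕ-unit m = invertible (record { mem = ℕ-mem m ; cancel = cancel })
      where
      cancel : ∀ {t} → t ∈ R → (m ℕ· 1#) * t ≈ 0# → t ≈ 0#
      cancel {t} t∈ mt≈0 with z , t≈ ← proj₁ spanning t∈ =
        trans t≈ (trans (sum-cong-≋ (λ i → ℤ·-congˡ (basis i) (z≡0 i))) (sum-replicate-zero rank))
        where
        z≡0 : ∀ i → z i ≡ 0ℤ
        z≡0 i = ℤ.*-cancelʳ-≡ (z i) 0ℤ (+ m) (independent (λ j → z j ℤ.* + m)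
          (begin
            _                                     ≈⟨ ℕ·-coordinates m z ⟨
            m ℕ· sum (λ j → z j ℤ· basis j)       ≈⟨ ×-congʳ m t≈ ⟨
            m ℕ· t                                ≈⟨ ℕ·≈*ˡ m t ⟩
            (m ℕ· 1#) * t                         ≈⟨ mt≈0 ⟩
            0#                                    ∎) i)

    ℕ·-cancel : ∀ m → .{{NonZero m}} → ∀ {x y} → m ℕ· x ≈ m ℕ· y → x ≈ y
    ℕ·-cancel m {x} {y} mx≈my with u , mu≈1 ← ℕ-unit m = begin
      x                    ≈⟨ inverse-cancel _ mu≈1 ⟨
      u * ((m ℕ· 1#) * x)  ≈⟨ *-congˡ (ℕ·≈*ˡ m x) ⟨
      u * (m ℕ· x)         ≈⟨ *-congˡ mx≈my ⟩
      u * (m ℕ· y)         ≈⟨ *-congˡ (ℕ·≈*ˡ m y) ⟩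
      u * ((m ℕ· 1#) * y)  ≈⟨ inverse-cancel _ mu≈1 ⟩
      y                    ∎

    -- The product of the denominators of the entries. Each of them is a non-zero-divisor of `R`, so
    -- the product is a unit of K.
    common-denominator : ∀ {n} (g : Vector Carrier n) →
                         ∃[ s ] s ∈ R × IsUnit s × (∀ i → (s * g i) ∈ R)
    common-denominator {ℕ.zero} g = 1# , 1-mem R-ring , (1# , *-identityˡ 1#) , λ ()
    common-denominator {suc n} g
      with r , s , r∈ , s-nzd , gs≈r ← fraction (head g)
         | t , t∈ , (t′ , tt′≈1) , tg∈ ← common-denominator (tail g)
      with s′ , ss′≈1 ← invertible s-nzd =
      s * t , R-*-closed R-ring s∈ t∈ ,
      (s′ * t′ , trans (*-Props.interchange s t s′ t′) (trans (*-cong ss′≈1 tt′≈1) (*-identityˡ 1#))) ,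
      λ where
        zero    → R-sub .resp (trans (*-congˡ (sym gs≈r)) (*-Props.x∙yz≈zx∙y t (head g) s))
                    (R-*-closed R-ring t∈ r∈)
        (suc i) → R-sub .resp (sym (*-assoc _ _ _)) (R-*-closed R-ring s∈ (tg∈ i))
      where s∈ = IsNonZeroDivisor.mem s-nzd

    module _ (R-full : Full R) where

      -- Some multiple m x has integer coordinates v. Since coordinates are unique and m can be
      -- cancelled, x lies in `R` exactly when m divides every coordinate, which is decidable in ℤ.
      R? : Decidable (_∈ R)
      R? x with m , m≢0 , mx∈ ← R-full x with v , mx≈ ← proj₁ spanning mx∈ =
        map′ divisible⇒∈ ∈⇒divisible (all? (λ i → + m ℤ.∣? v i))
        where
        instance _ = m≢0

        divisible⇒∈ : (∀ i → + m ℤ.∣ v i) → x ∈ R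
        divisible⇒∈ m∣v = proj₂ spanning (quotients , ℕ·-cancel m (begin
          m ℕ· x                                       ≈⟨ mx≈ ⟩
          sum (λ i → v i ℤ· basis i)                   ≈⟨ sum-cong-≋ (λ i → ℤ·-congˡ (basis i) (ℤ._∣_.equality (m∣v i))) ⟩
          sum (λ i → (quotients i ℤ.* + m) ℤ· basis i) ≈⟨ ℕ·-coordinates m quotients ⟨
          m ℕ· sum (λ i → quotients i ℤ· basis i)            ∎))
          where quotients = λ i → ℤ._∣_.quotient (m∣v i)

        ∈⇒divisible : x ∈ R → ∀ i → + m ℤ.∣ v i
        ∈⇒divisible x∈ i with w , x≈ ← proj₁ spanning x∈ =
          ℤ.divides (w i) (coordinates-unique v (λ j → w j ℤ.* + m)
            (trans (sym mx≈) (trans (×-congʳ m x≈) (ℕ·-coordinates m w))) i)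

    -- Decidable membership in a fractional ideal.

    module FractionalIdeal {I : Subset} (I-ideal : IsFractionalIdeal R I) where

      open IsFractionalIdeal I-ideal using (full; *-closed; finitelyGenerated)

      private
        n = proj₁ finitelyGenerated
        g = proj₁ (proj₂ finitelyGenerated)
        I≐Span = proj₂ (proj₂ finitelyGenerated)
        I-sub = ideal-isSubmonoid I-ideal

        m = proj₁ (full 1#)
        m1∈ = proj₂ (proj₂ (full 1#))

        instance m≢0 = proj₁ (proj₂ (full 1#))

        u = proj₁ (ℕ-unit m)
        mu≈1 = proj₂ (ℕ-unit m)

        -- Generators of (1/m) I, where m · 1 ∈ I. This module contains 1, and it will be the upper
        -- bound for `(I ∶ I)`.
        ug : Vector Carrier n
        ug i = u * g i

      I-least : ∀ {p} {U : Pred Carrier p} → IsSubmonoid U →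
                (∀ {r} i → r ∈ R → (r * g i) ∈ U) → ∀ {x} → x ∈ I → x ∈ U
      I-least U rg∈ x∈ = Span-least R g U rg∈ (proj₁ I≐Span x∈)

      g∈ : ∀ i → g i ∈ I
      g∈ i = proj₂ I≐Span (generator-∈-Span R-ring g i)

      -- A common denominator s of the generators gives s I ⊆ R. Fullness of `I` puts some k (x / s)
      -- into `I`, and multiplying by s puts k x into `R`. This supplies the hypothesis of `R?`.
      R-full : Full R
      R-full x with s , s∈ , (t , st≈1) , sg∈ ← common-denominator g
               with k , k≢0 , ktx∈ ← full (t * x) =
        k , k≢0 , R-sub .resp
          (trans (×-comm-* k s (t * x)) (×-congʳ k (inverse-cancel′ x st≈1)))
          (I-least (scaling-isSubmonoid s R-sub)
            (λ i r∈ → R-sub .resp (*-Props.x∙yz≈y∙xz _ _ _) (R-*-closed R-ring r∈ (sg∈ i))) ktx∈)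

      -- With u = 1/m, the ideal lies between m R and m/d R, so membership is
      -- a finite search for a residue modulo d that is congruent modulo m R.
      I? : Decidable (_∈ I)
      I? x with d , d≢0 , dug∈ ← common-multiple R-sub R-full ug =
        map′ congruent⇒∈ ∈⇒congruent (any? (λ e → R? R-full (u * (x - e))) es)
        where
        instance _ = d≢0

        residues-I : Residues d I
        residues-I = Residues-≐ d (≐-sym I≐Span) (residues-Span d {A = R} (residues-R d) g)

        es = proj₁ residues-I

        congruent⇒∈ : Any (λ e → (u * (x - e)) ∈ R) es → x ∈ I
        congruent⇒∈ p with e , e∈ , uxe∈ ← find p =
          I-sub .resp (begin
            (u * (x - e)) * (m ℕ· 1#) + e    ≈⟨ +-congʳ (*-Props.xy∙z≈x∙zy _ _ _) ⟩
            u * ((m ℕ· 1#) * (x - e)) + e    ≈⟨ +-congʳ (inverse-cancel _ mu≈1) ⟩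
            (x - e) + e                      ≈⟨ +-assoc _ _ _ ⟩
            x + (- e + e)                    ≈⟨ +-congˡ (-‿inverseˡ e) ⟩
            x + 0#                           ≈⟨ +-identityʳ x ⟩
            x                                ∎)
            (I-sub .+-closed (*-closed uxe∈ m1∈) (proj₁ (proj₂ residues-I) e∈))

        -- Here x - e = d y with y in `I`, and d I ⊆ m R by the choice of d.
        ∈⇒congruent : x ∈ I → Any (λ e → (u * (x - e)) ∈ R) es
        ∈⇒congruent x∈ with e , e∈ , y , y∈ , x≈ ← proj₂ (proj₂ residues-I) x∈ =
          lose e∈ (R-sub .resp (begin
            ((d ℕ· 1#) * u) * y       ≈⟨ *-Props.xy∙z≈y∙xz _ _ _ ⟩
            u * ((d ℕ· 1#) * y)       ≈⟨ *-congˡ (ℕ·≈*ˡ d y) ⟨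
            u * (d ℕ· y)              ≈⟨ *-congˡ (x+y-x≈y e (d ℕ· y)) ⟨
            u * ((e + d ℕ· y) - e)    ≈⟨ *-congˡ (+-congʳ x≈) ⟨
            u * (x - e)               ∎)
            (I-least (scaling-isSubmonoid ((d ℕ· 1#) * u) R-sub)
              (λ {r} i r∈ → R-sub .resp (begin
                r * (d ℕ· (u * g i))                 ≈⟨ *-congˡ (ℕ·≈*ˡ d (u * g i)) ⟩
                r * ((d ℕ· 1#) * (u * g i))          ≈⟨ *-congˡ (*-assoc _ _ _) ⟨
                r * (((d ℕ· 1#) * u) * g i)          ≈⟨ *-Props.x∙yz≈y∙xz _ _ _ ⟩
                ((d ℕ· 1#) * u) * (r * g i)          ∎)
                (R-*-closed R-ring r∈ (dug∈ i)))
              y∈))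

      -- The multiplicator ring is an over-order.

      T : Subset
      T = I ∶ I

      T-sub : IsSubmonoid T
      T-sub = ∶-isSubmonoid I I I-sub

      T-closed : Closed R T
      T-closed = ∶-closed I I I-sub *-closed

      T-full : Full T
      T-full = ∶-full I I I-sub *-closed full finitelyGenerated

      -- Stability of `I` under x need only be tested on the finitely many generators of `I`.
      T? : Decidable (_∈ T)
      T? x = map′
        (λ xg∈ {y} y∈ → I-least (scaling-isSubmonoid x I-sub)
          (λ i r∈ → I-sub .resp (*-Props.x∙yz≈y∙xz _ _ _) (*-closed r∈ (xg∈ i))) y∈)
        (λ x∈ i → x∈ (g∈ i))
        (all? (λ i → I? (x * g i)))

      -- If x I ⊆ I, then x m lies in `I` because m does, and x = (1/m) (x m).
      T⊆Span : T ⊆ Span R ug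
      T⊆Span {x} x∈ = span .resp (trans (*-congˡ (*-comm _ _)) (inverse-cancel _ mu≈1))
        (I-least (scaling-isSubmonoid u span)
          (λ i r∈ → span .resp (*-Props.x∙yz≈y∙xz _ _ _) (Span-scaled-generator R R-sub ug r∈ i))
          (x∈ m1∈))
        where span = Span-isSubmonoid R R-sub ug

      -- By fullness of `T` some d brings all generators of (1/m) I into `T`, so `T` is squeezed
      -- between d (1/m) I and (1/m) I.
      T-finitelyGenerated : FinitelyGenerated R T
      T-finitelyGenerated with d , d≢0 , dug∈ ← common-multiple T-sub T-full ug =
        sandwiched-finitelyGenerated R-ring T-sub T-closed T? d ug
          (residues-Span d {A = R} (residues-R d {{d≢0}}) ug) dug∈ T⊆Span

      T-isSubring : IsSubring T
      T-isSubring = record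
        { resp     = T-sub .resp
        ; 0-mem    = T-sub .0-mem
        ; 1-mem    = λ y∈ → I-sub .resp (sym (*-identityˡ _)) y∈
        ; +-closed = T-sub .+-closed
        ; neg-mem  = neg-closed R-ring T-sub T-closed
        ; *-closed = λ x∈ y∈ z∈ → I-sub .resp (sym (*-assoc _ _ _)) (x∈ (y∈ z∈))
        }

      multiplicatorRing-isOverOrder : IsOverOrder R T
      multiplicatorRing-isOverOrder = record
        { resp              = T-sub .resp
        ; 0-mem             = T-sub .0-mem
        ; +-closed          = T-sub .+-closed
        ; *-closed          = T-closed
        ; finitelyGenerated = T-finitelyGenerated
        ; full              = T-full
        } , T-isSubring

  -- Weak equivalence and invertible ideals

  -- The inclusions β A ⊆ B and α B ⊆ A for inverse scalars. Unlike `_≃_`, this form is visibly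
  -- symmetric, so one direction of an argument yields the other by exchanging α and β.
  record Isomorphism (A B : Subset) : Set (c ⊔ ℓ) where
    field
      α β  : Carrier
      αβ≈1 : α * β ≈ 1#
      to   : ∀ {x} → x ∈ A → (β * x) ∈ B
      from : ∀ {x} → x ∈ B → (α * x) ∈ A

  ≃⇒Isomorphism : ∀ {A B} → IsSubmonoid B → A ≃ B → Isomorphism A B
  ≃⇒Isomorphism B-sub (α , (β , αβ≈1) , A⊆ , ⊆A) = record
    { α = α ; β = β ; αβ≈1 = αβ≈1
    ; to   = λ x∈ → let y , y∈ , x≈ = A⊆ x∈ in
               B-sub .resp (sym (trans (*-congˡ x≈) (inverse-cancel y αβ≈1))) y∈
    ; from = λ {x} x∈ → ⊆A (x , x∈ , refl)
    }

  Isomorphism⇒≃ : ∀ {A B} → IsSubmonoid A → Isomorphism A B → A ≃ B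
  Isomorphism⇒≃ A-sub i = α , (β , αβ≈1) ,
    (λ {x} x∈ → β * x , to x∈ , sym (inverse-cancel′ x αβ≈1)) ,
    (λ (y , y∈ , x≈) → A-sub .resp (sym x≈) (from y∈))
    where open Isomorphism i

  Isomorphism-sym : ∀ {A B} → Isomorphism A B → Isomorphism B A
  Isomorphism-sym i = record
    { α = β ; β = α ; αβ≈1 = trans (*-comm β α) αβ≈1 ; to = from ; from = to }
    where open Isomorphism i

  -- For y in `B`, x y = β (x (α y)), and α y lies in `A`.
  Isomorphism⇒∶⊆∶ : ∀ {A B} → IsSubmonoid B → Isomorphism A B → (A ∶ A) ⊆ (B ∶ B)
  Isomorphism⇒∶⊆∶ B-sub i {x} x∈ {y} y∈ =
    B-sub .resp (trans (*-congˡ (*-Props.x∙yz≈y∙xz x α y)) (inverse-cancel (x * y) αβ≈1))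
      (to (x∈ (from y∈)))
    where open Isomorphism i

  ·-comm : ∀ A B → A · B ⊆ B · A
  ·-comm A B = ·-least A B (·-isSubmonoid B A) λ a∈ b∈ →
    ·-isSubmonoid B A .resp (*-comm _ _) (·-intro B A b∈ a∈)

  -- If 1 lies in L L′, then every x ∈ L equals Σ (x bᵢ) aᵢ where 1 = Σ aᵢ bᵢ.
  inverse⇒finitelyGenerated : ∀ {S L L′} → IsSubmonoid L → Closed S L →
    (∀ {x b} → x ∈ L → b ∈ L′ → (x * b) ∈ S) → 1# ∈ L · L′ → FinitelyGenerated S L
  inverse⇒finitelyGenerated {S} L-sub L-closed LL′⊆S (n , a , b , a∈ , b∈ , 1≈) = n , a ,
    (λ {x} x∈ → (λ i → x * b i) , (λ i → LL′⊆S x∈ (b∈ i)) , (begin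
      x                                   ≈⟨ *-identityʳ x ⟨
      x * 1#                              ≈⟨ *-congˡ 1≈ ⟩
      x * sum (λ i → a i * b i)           ≈⟨ *-distribˡ-sum x (λ i → a i * b i) ⟩
      sum (λ i → x * (a i * b i))         ≈⟨ sum-cong-≋ (λ i → *-Props.x∙yz≈xz∙y x (a i) (b i)) ⟩
      sum (λ i → (x * b i) * a i)         ∎)) ,
    Span-least S a L-sub (λ i s∈ → L-closed s∈ (a∈ i))

  -- From weak equivalence to a product with an invertible ideal.

  module _ {R S I W : Subset} (I-ideal : IsFractionalIdeal R I) (W-ideal : IsFractionalIdeal R W)
           (S-ring : IsSubring S) (I∶I≐S : (I ∶ I) ≐ S) (W∶W≐S : (W ∶ W) ≐ S)
           (I∼W : WeaklyEquivalent I W) where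

    private
      module I = IsFractionalIdeal I-ideal
      module W = IsFractionalIdeal W-ideal
      I-sub = ideal-isSubmonoid I-ideal
      W-sub = ideal-isSubmonoid W-ideal
      L = I ∶ W
      L′ = W ∶ I

      I-closed : Closed S I
      I-closed s∈ = proj₂ I∶I≐S s∈

      W-closed : Closed S W
      W-closed s∈ = proj₂ W∶W≐S s∈

      LL′⊆S : ∀ {x b} → x ∈ L → b ∈ L′ → (x * b) ∈ S
      LL′⊆S x∈ b∈ = proj₁ I∶I≐S λ y∈ → I-sub .resp (sym (*-assoc _ _ _)) (x∈ (b∈ y∈))

      L′L⊆S : ∀ {x b} → x ∈ L′ → b ∈ L → (x * b) ∈ S
      L′L⊆S x∈ b∈ = proj₁ W∶W≐S λ y∈ → W-sub .resp (sym (*-assoc _ _ _)) (x∈ (b∈ y∈))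

      L-sub : IsSubmonoid L
      L-sub = ∶-isSubmonoid I W I-sub

      L′-sub : IsSubmonoid L′
      L′-sub = ∶-isSubmonoid W I W-sub

      L-closed : Closed S L
      L-closed = ∶-closed I W I-sub I-closed

      L′-closed : Closed S L′
      L′-closed = ∶-closed W I W-sub W-closed

      L-ideal : IsFractionalIdeal S L
      L-ideal = record
        { resp              = L-sub .resp
        ; 0-mem             = L-sub .0-mem
        ; +-closed          = L-sub .+-closed
        ; *-closed          = L-closed
        ; finitelyGenerated = inverse⇒finitelyGenerated {S} {L} {L′} L-sub L-closed LL′⊆S I∼W
        ; full              = ∶-full I W I-sub I.*-closed I.full W.finitelyGenerated
        }

      L′-ideal : IsFractionalIdeal S L′
      L′-ideal = record
        { resp              = L′-sub .resp
        ; 0-mem             = L′-sub .0-mem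
        ; +-closed          = L′-sub .+-closed
        ; *-closed          = L′-closed
        ; finitelyGenerated = inverse⇒finitelyGenerated {S} {L′} {L} L′-sub L′-closed L′L⊆S (·-comm L L′ I∼W)
        ; full              = ∶-full W I W-sub W.*-closed W.full I.finitelyGenerated
        }

    -- Composing W → I and I → W shows (I : W)(W : I) ⊆ (I : I) = S. Weak equivalence puts 1 into
    -- this product, which is stable under `S`, so it is all of `S`.
    ∶-isInvertible : IsInvertible S (I ∶ W)
    ∶-isInvertible = L-ideal , L′ , L′-ideal ,
      ·-least L L′ (subring-isSubmonoid S-ring) LL′⊆S ,
      λ s∈ → ·-isSubmonoid L L′ .resp (*-identityʳ _) (·-closed L L′ {S} L-closed s∈ I∼W)

    -- Write 1 = Σ aᵢ bᵢ with aᵢ ∈ (I : W) and bᵢ ∈ (W : I). Then β x = Σ (bᵢ x)(β aᵢ) lies in W J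
    -- for x in `I`. Conversely α (w j) = (α j) w lies in `I`, since α j ∈ (I : W).
    weaklyEquivalent⇒≃· : ∀ {J} → IsSubmonoid J → (I ∶ W) ≃ J → I ≃ W · J
    weaklyEquivalent⇒≃· {J} J-sub L≃J = Isomorphism⇒≃ I-sub record
      { α = α ; β = β ; αβ≈1 = αβ≈1
      ; to   = λ {x} x∈ → WJ-sub .resp (*-identityʳ _)
          (·-least L L′ (scaling-isSubmonoid (β * x) WJ-sub)
            (λ {a} {b} a∈ b∈ → WJ-sub .resp (regroup x a b) (·-intro W J (b∈ x∈) (to a∈))) I∼W)
      ; from = ·-least W J (scaling-isSubmonoid α I-sub) λ w∈ j∈ →
          I-sub .resp (trans (*-assoc _ _ _) (*-congˡ (*-comm _ _))) (from j∈ w∈)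
      }
      where
      open Isomorphism (≃⇒Isomorphism J-sub L≃J)
      WJ-sub = ·-isSubmonoid W J

      regroup : ∀ x a b → (b * x) * (β * a) ≈ (β * x) * (a * b)
      regroup x a b = begin
        (b * x) * (β * a)  ≈⟨ *-comm _ _ ⟩
        (β * a) * (b * x)  ≈⟨ *-congˡ (*-comm b x) ⟩
        (β * a) * (x * b)  ≈⟨ *-Props.interchange β a x b ⟩
        (β * x) * (a * b)  ∎

  -- Recovering multiplicator ring, weak class and Picard class from a product.

  module _ {S W : Subset} (J N : Subset) (W-sub : IsSubmonoid W) (W∶W≐S : (W ∶ W) ≐ S) (JN≐S : J · N ≐ S) where

    private
      W-closed : Closed S W
      W-closed s∈ = proj₂ W∶W≐S s∈

    -- The inverse `N` undoes `J`: N (W J) = W (J N) = W S ⊆ W.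
    ·-cancel : ∀ {b x} → b ∈ N → x ∈ W · J → (b * x) ∈ W
    ·-cancel {b} b∈ = ·-least W J (scaling-isSubmonoid b W-sub) λ w∈ j∈ →
      W-sub .resp (*-Props.xy∙z≈y∙zx _ _ _) (W-closed (proj₁ JN≐S (·-intro J N j∈ b∈)) w∈)

    -- Let x stabilise W J and write 1 = Σ jᵢ bᵢ in J N. Then x w = Σ bᵢ (x (w jᵢ)) lies in N (W J)
    -- ⊆ W, so x ∈ (W : W) = S.
    multiplicatorRing-· : 1# ∈ S → ((W · J) ∶ (W · J)) ≐ S
    multiplicatorRing-· 1∈S =
      (λ {x} x∈ → proj₁ W∶W≐S λ {w} w∈ → W-sub .resp (*-identityʳ _)
        (·-least J N (scaling-isSubmonoid (x * w) W-sub)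
          (λ {j} {b} j∈ b∈ → W-sub .resp (regroup x w j b) (·-cancel b∈ (x∈ (·-intro W J w∈ j∈))))
          (proj₂ JN≐S 1∈S))) ,
      λ s∈ → ·-closed W J {S} W-closed s∈
      where
      regroup : ∀ x w j b → b * (x * (w * j)) ≈ (x * w) * (j * b)
      regroup x w j b = begin
        b * (x * (w * j))  ≈⟨ *-congˡ (*-assoc x w j) ⟨
        b * ((x * w) * j)  ≈⟨ *-Props.x∙yz≈y∙zx _ _ _ ⟩
        (x * w) * (j * b)  ∎

    -- Multiplying α W′ J′ ⊆ W J by `N` gives (α J′ N) W′ ⊆ W.
    ·⊆·⇒∈∶ : ∀ W′ J′ {α} → (∀ {x} → x ∈ W′ · J′ → (α * x) ∈ W · J) →
             ∀ {a b} → a ∈ J′ → b ∈ N → (α * (a * b)) ∈ (W ∶ W′)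
    ·⊆·⇒∈∶ W′ J′ {α} W′J′⊆ {a} {b} a∈ b∈ {w} w∈ =
      W-sub .resp (begin
        b * (α * (w * a))  ≈⟨ *-Props.x∙yz≈y∙xz b α (w * a) ⟩
        α * (b * (w * a))  ≈⟨ *-congˡ (*-Props.x∙yz≈zx∙y b w a) ⟩
        α * ((a * b) * w)  ≈⟨ *-assoc α (a * b) w ⟨
        (α * (a * b)) * w  ∎)
        (·-cancel b∈ (W′J′⊆ (·-intro W′ J′ w∈ a∈)))

  module _ {S W W′ : Subset} (J N J′ N′ : Subset) (S-ring : IsSubring S)
           (W-sub : IsSubmonoid W) (W∶W≐S : (W ∶ W) ≐ S) (JN≐S : J · N ≐ S)
           (W′-sub : IsSubmonoid W′) (W′∶W′≐S : (W′ ∶ W′) ≐ S) (J′N′≐S : J′ · N′ ≐ S)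
           (WJ≃W′J′ : W · J ≃ W′ · J′) where

    private
      open Isomorphism (≃⇒Isomorphism (·-isSubmonoid W′ J′) WJ≃W′J′)

      α∈ : ∀ {a b} → a ∈ J′ → b ∈ N → (α * (a * b)) ∈ (W ∶ W′)
      α∈ = ·⊆·⇒∈∶ J N W-sub W∶W≐S JN≐S W′ J′ from

      β∈ : ∀ {c d} → c ∈ J → d ∈ N′ → (β * (c * d)) ∈ (W′ ∶ W)
      β∈ = ·⊆·⇒∈∶ J′ N′ W′-sub W′∶W′≐S J′N′≐S W J to

    -- Multiply an expression of 1 in J N by one in J′ N′. Since α β = 1, each term (c b)(a d)
    -- regroups as (α a b)(β c d), whose factors lie in (W : W′) and (W′ : W).
    ·≃·⇒weaklyEquivalent : WeaklyEquivalent W W′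
    ·≃·⇒weaklyEquivalent = ·-least J N P-sub
      (λ {c} {b} c∈ b∈ → P-sub .resp (*-identityʳ _)
        (·-least J′ N′ (scaling-isSubmonoid (c * b) P-sub)
          (λ {a} {d} a∈ d∈ → P-sub .resp (regroup a b c d)
            (·-intro (W ∶ W′) (W′ ∶ W) (α∈ a∈ b∈) (β∈ c∈ d∈)))
          (proj₂ J′N′≐S (1-mem S-ring))))
      (proj₂ JN≐S (1-mem S-ring))
      where
      P-sub = ·-isSubmonoid (W ∶ W′) (W′ ∶ W)

      regroup : ∀ a b c d → (α * (a * b)) * (β * (c * d)) ≈ (c * b) * (a * d)
      regroup a b c d = begin
        (α * (a * b)) * (β * (c * d))  ≈⟨ *-Props.interchange _ _ _ _ ⟩
        (α * β) * ((a * b) * (c * d))  ≈⟨ trans (*-congʳ αβ≈1) (*-identityˡ _) ⟩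
        (a * b) * (c * d)              ≈⟨ *-congʳ (*-comm a b) ⟩
        (b * a) * (c * d)              ≈⟨ *-Props.interchange b a c d ⟩
        (b * c) * (a * d)              ≈⟨ *-congʳ (*-comm b c) ⟩
        (c * b) * (a * d)              ∎

  module _ {S : Subset} (J N : Subset) (S-ring : IsSubring S) (J-sub : IsSubmonoid J) (J-closed : Closed S J)
           (JN≐S : J · N ≐ S) where

    -- This is (S : N) ⊆ J: with 1 = Σ jᵢ bᵢ in J N, x = Σ (x bᵢ) jᵢ has coefficients in `S`.
    ∈-of-inverse : ∀ {x} → (∀ {b} → b ∈ N → (x * b) ∈ S) → x ∈ J
    ∈-of-inverse {x} xN⊆S = J-sub .resp (*-identityʳ x)
      (·-least J N (scaling-isSubmonoid x J-sub)
        (λ j∈ b∈ → J-sub .resp (*-Props.xy∙z≈x∙zy _ _ _) (J-closed (xN⊆S b∈) j∈))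
        (proj₂ JN≐S (1-mem S-ring)))

  -- For equal first factors the colon of `·⊆·⇒∈∶` is (W : W) = S, so α J′ N ⊆ S and therefore α J′
  -- ⊆ J. The same argument with β gives β J ⊆ J′, so the scalars of the given isomorphism serve
  -- unchanged.
  ·-cancelˡ-≃ : ∀ {S W J J′} → IsSubring S → IsSubmonoid W → (W ∶ W) ≐ S →
                IsInvertible S J → IsInvertible S J′ → W · J ≃ W · J′ → J ≃ J′
  ·-cancelˡ-≃ {S} {W} {J} {J′} S-ring W-sub W∶W≐S (J-ideal , N , _ , JN≐S) (J′-ideal , N′ , _ , J′N′≐S) WJ≃WJ′ =
    Isomorphism⇒≃ J-sub record
      { α = α ; β = β ; αβ≈1 = αβ≈1
      ; to   = λ c∈ → ∈-of-inverse J′ N′ S-ring J′-sub J′.*-closed J′N′≐S λ d∈ →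
          S-sub .resp (sym (*-assoc _ _ _)) (proj₁ W∶W≐S (·⊆·⇒∈∶ J′ N′ W-sub W∶W≐S J′N′≐S W J to c∈ d∈))
      ; from = λ a∈ → ∈-of-inverse J N S-ring J-sub J.*-closed JN≐S λ b∈ →
          S-sub .resp (sym (*-assoc _ _ _)) (proj₁ W∶W≐S (·⊆·⇒∈∶ J N W-sub W∶W≐S JN≐S W J′ from a∈ b∈))
      }
    where
    open Isomorphism (≃⇒Isomorphism (·-isSubmonoid W J′) WJ≃WJ′)
    module J = IsFractionalIdeal J-ideal
    module J′ = IsFractionalIdeal J′-ideal
    J-sub = ideal-isSubmonoid J-ideal
    J′-sub = ideal-isSubmonoid J′-ideal
    S-sub = subring-isSubmonoid S-ring

  -- Correctness of the list of products.

  module Algorithm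
    {R : Subset} (R-order : IsOrder R) (tq : IsTotalQuotientRing R)
    (𝓛ᵒ : List Subset) (overOrders : AreOverOrders R 𝓛ᵒ)
    (𝓛ʷ : Fin (length 𝓛ᵒ) → List Subset) (weakClasses : ∀ k → Represent𝒲 R (lookup 𝓛ᵒ k) (𝓛ʷ k))
    (𝓛ⁱ : Fin (length 𝓛ᵒ) → List Subset) (picClasses : ∀ k → RepresentPic (lookup 𝓛ᵒ k) (𝓛ⁱ k))
    where

    open IsListOfRepresentatives
    open OrderProperties R-order tq
    open IsOrder R-order using () renaming (isSubring to R-ring)

    S : Fin (length 𝓛ᵒ) → Subset
    S = lookup 𝓛ᵒ

    S-ring : ∀ k → IsSubring (S k)
    S-ring k = proj₂ (All.lookup (overOrders .sound) (∈-lookup k))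

    block : Fin (length 𝓛ᵒ) → List Subset
    block k = cartesianProductWith _·_ (𝓛ʷ k) (𝓛ⁱ k)

    ·-hasMultiplicatorRing : ∀ k {W J} → HasMultiplicatorRing R (S k) W → IsInvertible (S k) J →
                             HasMultiplicatorRing R (S k) (W · J)
    ·-hasMultiplicatorRing k {W} {J} (W-ideal , W∶W≐S) (J-ideal , N , _ , JN≐S) =
      ·-isFractionalIdeal R-ring (S-ring k) (λ s∈ → proj₂ W∶W≐S s∈) W-ideal J-ideal ,
      multiplicatorRing-· J N (ideal-isSubmonoid W-ideal) W∶W≐S JN≐S (1-mem (S-ring k))

    block-sound : ∀ k → All (HasMultiplicatorRing R (S k)) (block k)
    block-sound k = All.tabulate λ x∈ → case ∈-cartesianProductWith⁻ _·_ (𝓛ʷ k) (𝓛ⁱ k) x∈ of λ where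
      (W , J , W∈ , J∈ , ≡.refl) →
        ·-hasMultiplicatorRing k (All.lookup (weakClasses k .sound) W∈) (All.lookup (picClasses k .sound) J∈)

    block-distinct : ∀ k → AllPairs (λ I J → ¬ (I ≃ J)) (block k)
    block-distinct k = AllPairs-cartesianProductWith _·_
      (weakClasses k .sound) (picClasses k .sound) (weakClasses k .distinct) (picClasses k .distinct)
      (λ {_} {_} {J} {J′} (W-ideal , W∶W≐S) (W′-ideal , W′∶W′≐S) (_ , N , _ , JN≐S) (_ , N′ , _ , J′N′≐S) W≁W′ WJ≃W′J′ →
        W≁W′ (·≃·⇒weaklyEquivalent J N J′ N′ (S-ring k)
          (ideal-isSubmonoid W-ideal) W∶W≐S JN≐S (ideal-isSubmonoid W′-ideal) W′∶W′≐S J′N′≐S WJ≃W′J′))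
      (λ (W-ideal , W∶W≐S) J-inv J′-inv J≄J′ WJ≃WJ′ →
        J≄J′ (·-cancelˡ-≃ (S-ring k) (ideal-isSubmonoid W-ideal) W∶W≐S J-inv J′-inv WJ≃WJ′))

    -- Isomorphic ideals have the same multiplicator ring, so an isomorphism across two blocks would
    -- identify over-orders at different positions of `𝓛ᵒ`.
    blocks-distinct : ∀ {j k} → j ≢ k → All (λ I → All (λ J → ¬ (I ≃ J)) (block k)) (block j)
    blocks-distinct {j} {k} j≢k =
      All.map (λ I-mult → All.map (λ J-mult → separate I-mult J-mult) (block-sound k)) (block-sound j)
      where
      separate : ∀ {I J} → HasMultiplicatorRing R (S j) I → HasMultiplicatorRing R (S k) J → ¬ (I ≃ J)
      separate (I-ideal , I∶I≐S) (J-ideal , J∶J≐S) I≃J =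
        AllPairs-lookup (_∘ ≐-sym) (overOrders .distinct) j≢k
          (≐-trans (≐-sym I∶I≐S) (≐-trans
            ( Isomorphism⇒∶⊆∶ (ideal-isSubmonoid J-ideal) iso
            , Isomorphism⇒∶⊆∶ (ideal-isSubmonoid I-ideal) (Isomorphism-sym iso)) J∶J≐S))
        where iso = ≃⇒Isomorphism (ideal-isSubmonoid J-ideal) I≃J

    -- Three lookups in turn: the over-order `(I ∶ I)` determines the block k, the weak class of `I`
    -- determines `W`, and the Picard class of `(I ∶ W)` determines the second factor.
    classes-complete : ∀ I → IsFractionalIdeal R I → Any (I ≃_) (idealClassList 𝓛ᵒ 𝓛ʷ 𝓛ⁱ)
    classes-complete I I-ideal =
      lose (∈-concatMap⁺ block (lose (∈-allFin k) (∈-cartesianProductWith⁺ _·_ W∈ J∈)))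
        (weaklyEquivalent⇒≃· I-ideal W-ideal (S-ring k) I∶I≐S W∶W≐S I∼W
          (ideal-isSubmonoid (proj₁ (All.lookup (picClasses k .sound) J∈))) L≃J)
      where
      open FractionalIdeal I-ideal

      position : Any ((I ∶ I) ≐_) 𝓛ᵒ
      position = overOrders .complete (I ∶ I) multiplicatorRing-isOverOrder

      k = Any.index position

      I∶I≐S : (I ∶ I) ≐ S k
      I∶I≐S = lookup-index position

      weakClass = find (weakClasses k .complete I (I-ideal , I∶I≐S))
      W = proj₁ weakClass
      W∈ = proj₁ (proj₂ weakClass)
      I∼W = proj₂ (proj₂ weakClass)
      W-ideal = proj₁ (All.lookup (weakClasses k .sound) W∈)
      W∶W≐S = proj₂ (All.lookup (weakClasses k .sound) W∈)

      picClass = find (picClasses k .complete (I ∶ W)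
        (∶-isInvertible I-ideal W-ideal (S-ring k) I∶I≐S W∶W≐S I∼W))
      J∈ = proj₁ (proj₂ picClass)
      L≃J = proj₂ (proj₂ picClass)

    representICM : RepresentICM R (idealClassList 𝓛ᵒ 𝓛ʷ 𝓛ⁱ)
    representICM = record
      { sound    = All.concat⁺ (All.map⁺ {xs = allFin _} (All.tabulate λ {k} _ → All.map proj₁ (block-sound k)))
      ; complete = classes-complete
      ; distinct = AllPairs.concat⁺ (All.map⁺ (All.tabulate λ {k} _ → block-distinct k))
                     (AllPairs.map⁺ {f = block} (AllPairs.tabulate⁺ blocks-distinct))
      }

theorem6p4 : ∀ {c ℓ} (K : CommutativeRing c ℓ) → let open Orders K in
    (R : Subset) → IsOrder R → IsTotalQuotientRing R →
    (𝓛ᵒ : List Subset) → AreOverOrders R 𝓛ᵒ →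
    (𝓛ʷ : Fin (length 𝓛ᵒ) → List Subset) →
    (∀ k → Represent𝒲 R (lookup 𝓛ᵒ k) (𝓛ʷ k)) →
    (𝓛ⁱ : Fin (length 𝓛ᵒ) → List Subset) →
    (∀ k → RepresentPic (lookup 𝓛ᵒ k) (𝓛ⁱ k)) →
    RepresentICM R (idealClassList 𝓛ᵒ 𝓛ʷ 𝓛ⁱ)
theorem6p4 K R R-order tq 𝓛ᵒ overOrders 𝓛ʷ weakClasses 𝓛ⁱ picClasses =
  Algorithm.representICM K R-order tq 𝓛ᵒ overOrders 𝓛ʷ weakClasses 𝓛ⁱ picClasses
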